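{- If there exists a rapid ultrafilter $p$ on $\mathbb{N}$, then there exist rapid idempotent ultrafilters on $\mathbb{N}$. More precisely, if $p$ is a rapid ultrafilter on $\mathbb{N}$, then every element of $\beta\mathbb{N}+p=\{q+p : q\in\beta\mathbb{N}\}$ is a rapid ultrafilter; in particular, $\beta\mathbb{N}+p$ contains minimal idempotents (of the semigroup $(\beta\mathbb{N},+)$) which are rapid.
   Context: $\mathbb{N}=\{1,2,3,\dots\}$ is the set of positive integers, and $\beta\mathbb{N}$ is the set of all ultrafilters on $\mathbb{N}$ (principal ones included), with its usual topology as the Stone–Čech compactification of discrete $\mathbb{N}$. Rapid: an ultrafilter $p$ on $\mathbb{N}$ is rapid if for every function $f:\mathbb{N}\to\mathbb{N}$ there exists $A\in p$ such that $|A\cap f(i)|<i$ for all $i\in\mathbb{N}$, where the natural number $f(i)$ is identified with the set of its predecessors, so that $A\cap f(i)=\{a\in A: a<f(i)\}$. Tensor product and sum: for $q,p\in\beta\mathbb{N}$, $q\otimes p$ is the ultrafilter on $\mathbb{N}\times\mathbb{N}$ generated by the sets $\bigcup_{v\in V}\{v\}\times W_v$ with $V\in q$ and $W_v\in p$ for each $v\in V$. The sum $q+p$ is the image of $q\otimes p$ under the addition map $+:\mathbb{N}\times\mathbb{N}\to\mathbb{N}$; equivalently, $A\in q+p$ if and only if $\{v\in\mathbb{N}: \{w\in\mathbb{N}: v+w\in A\}\in p\}\in q$. With this operation $\beta\mathbb{N}$ is a semigroup. Idempotents: $e\in\beta\mathbb{N}$ is idempotent if $e+e=e$. An idempotent $e$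 is minimal if it is minimal among the idempotents of $\beta\mathbb{N}$ with respect to the order $e\le e' \Leftrightarrow e+e'=e'+e=e$; equivalently, $e$ belongs to a minimal left ideal of $(\beta\mathbb{N},+)$ (a left ideal being a nonempty $L\subseteq\beta\mathbb{N}$ with $\beta\mathbb{N}+L\subseteq L$). -}

module Defs where

open import Algebra.Bundles using (Semigroup)
import Algebra.Definitions as AlgDefs
open import Data.Empty using (⊥-elim)
open import Data.List.Base using (List; length)
open import Data.List.Membership.Propositional using () renaming (_∈_ to _∈ˡ_)
open import Data.List.Relation.Unary.Unique.Propositional using (Unique)
import Data.Nat.Base as ℕ
open ℕ using (ℕ; suc; NonZero)
import Data.Nat.Properties as ℕ
open import Data.Product.Base using (_×_; _,_; ∃-syntax; Σ-syntax; uncurry)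
open import Data.Sum.Base using (_⊎_)
import Data.Sum.Base as Sum
open import Function.Base using (id)
open import Function.Bundles using (_⇔_; mk⇔)
open import Level using (Level; 0ℓ; _⊔_)
open import Relation.Binary.PropositionalEquality using (_≡_; refl; sym; subst)
open import Relation.Unary using (Pred; _∈_; _∉_; _⊆_; _∩_; _⊢_; ∁; U; ∅; _≐′_)

-- The positive integers.  The proof is irrelevant, so equality is equality
-- of the underlying naturals.

record ℕ⁺ : Set where
  constructor pos
  field
    toℕ          : ℕ
    .{{nonZero}} : NonZero toℕ

open ℕ⁺ public using (toℕ)

m+n≢0 : ∀ m n → .{{NonZero m}} → NonZero (m ℕ.+ n)
m+n≢0 (suc m) n = _

infixl 6 _+⁺_
infix  4 _<⁺_

_+⁺_ : ℕ⁺ → ℕ⁺ → ℕ⁺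
pos m +⁺ pos n = pos (m ℕ.+ n) {{m+n≢0 m n}}

_<⁺_ : ℕ⁺ → ℕ⁺ → Set
m <⁺ n = toℕ m ℕ.< toℕ n

toℕ-injective : ∀ {m n} → toℕ m ≡ toℕ n → m ≡ n
toℕ-injective refl = refl

+⁺-assoc : ∀ a b c → (a +⁺ b) +⁺ c ≡ a +⁺ (b +⁺ c)
+⁺-assoc a b c = toℕ-injective (ℕ.+-assoc (toℕ a) (toℕ b) (toℕ c))

HasCardinality : {X : Set} → Pred X 0ℓ → ℕ → Set
HasCardinality {X} S k =
  ∃[ xs ] Unique xs × (∀ (x : X) → x ∈ˡ xs ⇔ x ∈ S) × length xs ≡ k

∣_∣<_ : {X : Set} → Pred X 0ℓ → ℕ → Set
∣ S ∣< n = ∃[ k ] HasCardinality S k × k ℕ.< n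

-- Families of subsets take values in Set: given excluded middle, every
-- proposition is equivalent to one in Set, so no subset or family is lost.

record Ultrafilter (X : Set) : Set₁ where
  field
    Large    : Pred (Pred X 0ℓ) 0ℓ
    U-large  : U ∈ Large
    ∅-small  : ∅ ∉ Large
    ⊆-closed : ∀ {A B} → A ⊆ B → A ∈ Large → B ∈ Large
    ∩-closed : ∀ {A B} → A ∈ Large → B ∈ Large → A ∩ B ∈ Large
    ultra    : ∀ A → A ∈ Large ⊎ ∁ A ∈ Large

open Ultrafilter public

infix 4 _∈ᵘ_ _≈_

_∈ᵘ_ : {X : Set} → Pred X 0ℓ → Ultrafilter X → Set
A ∈ᵘ p = A ∈ Large p

_≈_ : {X : Set} → Ultrafilter X → Ultrafilter X → Set₁
p ≈ q = Large p ≐′ Large q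

image : {X Y : Set} → (X → Y) → Ultrafilter X → Ultrafilter Y
image f p = record
  { Large    = λ B → (f ⊢ B) ∈ᵘ p
  ; U-large  = U-large p
  ; ∅-small  = ∅-small p
  ; ⊆-closed = λ A⊆B → ⊆-closed p A⊆B
  ; ∩-closed = ∩-closed p
  ; ultra    = λ B → ultra p (f ⊢ B)
  }

-- Described by the sections of its members, which keeps membership in Set;
-- ⊗-generated shows that it is the ultrafilter generated by the sets
-- ⋃_{v ∈ V} {v} × W v.

infixr 7 _⊗_

_⊗_ : {X Y : Set} → Ultrafilter X → Ultrafilter Y → Ultrafilter (X × Y)
q ⊗ p = record
  { Large    = λ S → (λ v → (λ w → (v , w) ∈ S) ∈ᵘ p) ∈ᵘ q
  ; U-large  = ⊆-closed q (λ _ → U-large p) (U-large q)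
  ; ∅-small  = λ h → ∅-small q (⊆-closed q (∅-small p) h)
  ; ⊆-closed = λ A⊆B → ⊆-closed q (⊆-closed p A⊆B)
  ; ∩-closed = λ a b → ⊆-closed q (uncurry (∩-closed p)) (∩-closed q a b)
  ; ultra    = λ S → Sum.map₂
      (⊆-closed q (λ {v} v∉ → Sum.[ (λ h → ⊥-elim (v∉ h)) , id ]
                                (ultra p (λ w → (v , w) ∈ S))))
      (ultra q (λ v → (λ w → (v , w) ∈ S) ∈ᵘ p))
  }

⊗-generated : {X Y : Set} (q : Ultrafilter X) (p : Ultrafilter Y)
  (S : Pred (X × Y) 0ℓ) →
  S ∈ᵘ q ⊗ p ⇔
  (Σ[ V ∈ Pred X 0ℓ ] Σ[ W ∈ (X → Pred Y 0ℓ) ] V ∈ᵘ q × (∀ v → v ∈ V → W v ∈ᵘ p) ×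
     (∀ v w → v ∈ V → w ∈ W v → (v , w) ∈ S))
⊗-generated q p S = mk⇔
  (λ h → _ , (λ v w → (v , w) ∈ S) , h , (λ _ → id) , (λ _ _ _ → id))
  (λ (V , W , V∈q , W∈p , V×W⊆S) →
    ⊆-closed q (λ {v} v∈V → ⊆-closed p (λ {w} → V×W⊆S v w v∈V) (W∈p v v∈V)) V∈q)

βℕ : Set₁
βℕ = Ultrafilter ℕ⁺

infixl 6 _+_

_+_ : βℕ → βℕ → βℕ
q + p = image (uncurry _+⁺_) (q ⊗ p)

∈-+ : ∀ q p A → (A ∈ᵘ q + p) ≡ ((λ v → (λ w → v +⁺ w ∈ A) ∈ᵘ p) ∈ᵘ q)
∈-+ q p A = refl

βℕ-semigroup : Semigroup _ _
βℕ-semigroup = record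
  { Carrier = βℕ
  ; _≈_     = _≈_
  ; _∙_     = _+_
  ; isSemigroup = record
    { isMagma = record
      { isEquivalence = record
        { refl  = (λ _ → id) , (λ _ → id)
        ; sym   = λ (f , g) → g , f
        ; trans = λ (f , g) (f′ , g′) →
            (λ A a → f′ A (f A a)) , (λ A a → g A (g′ A a))
        }
      ; ∙-cong = λ {q} {q′} {p} {p′} (f , g) (f′ , g′) →
          (λ A h → f _ (⊆-closed q  (λ {v} → f′ (λ w → v +⁺ w ∈ A)) h)) ,
          (λ A h → g _ (⊆-closed q′ (λ {v} → g′ (λ w → v +⁺ w ∈ A)) h))
      }
    ; assoc = λ q p r →
        (λ A → ⊆-closed q λ {a} → ⊆-closed p λ {b} → ⊆-closed r λ {c} →
                 subst A (+⁺-assoc a b c)) ,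
        (λ A → ⊆-closed q λ {a} → ⊆-closed p λ {b} → ⊆-closed r λ {c} →
                 subst A (sym (+⁺-assoc a b c)))
    }
  }

module Idempotents {c ℓ : Level} (S : Semigroup c ℓ) where
  open Semigroup S using (Carrier; _∙_) renaming (_≈_ to _≈ˢ_)
  open AlgDefs _≈ˢ_ using (_IdempotentOn_)

  IsIdempotent : Pred Carrier ℓ
  IsIdempotent e = _∙_ IdempotentOn e

  infix 4 _≼_

  _≼_ : Carrier → Carrier → Set ℓ
  e ≼ e′ = (e ∙ e′ ≈ˢ e) × (e′ ∙ e ≈ˢ e)

  IsMinimalIdempotent : Pred Carrier (c ⊔ ℓ)
  IsMinimalIdempotent e =
    IsIdempotent e × (∀ e′ → IsIdempotent e′ → e′ ≼ e → e′ ≈ˢ e)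

open Idempotents βℕ-semigroup public using (IsIdempotent; IsMinimalIdempotent)

Rapid : Pred βℕ _
Rapid p = (f : ℕ⁺ → ℕ⁺) →
  ∃[ A ] A ∈ᵘ p × (∀ i → ∣ A ∩ (_<⁺ f i) ∣< toℕ i)

βℕ+_ : βℕ → Pred βℕ _
(βℕ+ p) r = ∃[ q ] r ≈ q + p

{-# OPTIONS --safe #-}
module Submission where

open import Defs
open import Axiom.ExcludedMiddle using (ExcludedMiddle)
open import Axiom.Extensionality.Propositional using (Extensionality)
open import Data.Bool.Base using (T)
open import Data.List.Base
  using (List; []; _∷_; map; length; filter; deduplicate; upTo; cartesianProductWith)
open import Data.List.Membership.Propositional using () renaming (_∈_ to _∈ˡ_)
open import Data.List.Membership.Propositional.Properties
  using (∈-map⁺; ∈-upTo⁺; ∈-filter⁺; ∈-filter⁻; ∈-deduplicate⁺; ∈-deduplicate⁻;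
         ∈-cartesianProductWith⁺)
open import Data.List.Properties using (length-++; length-map; length-upTo; length-filter)
import Data.List.Relation.Unary.Unique.DecPropositional.Properties as Unique
import Data.Nat.Base as ℕ
open ℕ using (ℕ; zero; suc; s≤s; z≤n)
import Data.Nat.Properties as ℕ
open import Data.Product.Base using (_×_; _,_; ∃-syntax; Σ-syntax; proj₁; proj₂)
open import Data.Sum.Base using (_⊎_; inj₁; inj₂; [_,_]′)
open import Data.Unit.Base using (tt)
open import Function.Base using (id; _∘_)
open import Function.Bundles using (mk⇔; Equivalence)
open import Level using (Level; 0ℓ; _⊔_) renaming (suc to lsuc)
open import Relation.Binary.Definitions using (DecidableEquality)
open import Relation.Binary.PropositionalEquality
  using (_≡_; refl; sym; trans; subst; cong; cong₂)
open import Relation.Nullary using (¬_; Dec; yes; no; contradiction; ¬?; does)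
open import Relation.Nullary.Decidable using (decidable-stable; does-⇔)
open import Relation.Unary using (Pred; _∈_; _∉_; _⊆_; _∩_; _⇒_; ∁; U; ∅)

-- Members of q + p are built from a single sparse A ∈ p by translating by each v
-- only a tail of A that starts so late that few v contribute below f(i).
--
-- Minimal idempotents are found by maximizing filters instead of minimizing
-- closed sets of ultrafilters: the union of a chain of proper filters is proper,
-- which replaces compactness.  A maximal translation-invariant filter M above the
-- filter of βℕ + p corresponds to a minimal closed left ideal, and a maximal filter
-- F ⊇ M with F ⊆ F · F is an idempotent ultrafilter e.  If e′ is an idempotent
-- below e, then M is the filter of βℕ + e′, so e = q + e′ and e = e + e′ = e′.

-- Counting with lists, squares and partial sums

length-cartesianProductWith : ∀ {a b c} {A : Set a} {B : Set b} {C : Set c}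
  (f : A → B → C) xs ys →
  length (cartesianProductWith f xs ys) ≡ length xs ℕ.* length ys
length-cartesianProductWith f []       ys = refl
length-cartesianProductWith f (x ∷ xs) ys = trans (length-++ (map (f x) ys))
  (cong₂ ℕ._+_ (length-map (f x) ys) (length-cartesianProductWith f xs ys))

length-deduplicate : ∀ {a} {A : Set a} (_≟_ : DecidableEquality A) xs →
  length (deduplicate _≟_ xs) ℕ.≤ length xs
length-deduplicate _≟_ []       = z≤n
length-deduplicate _≟_ (x ∷ xs) = s≤s (ℕ.≤-trans
  (length-filter (λ y → ¬? (x ≟ y)) (deduplicate _≟_ xs))
  (length-deduplicate _≟_ xs))

square-cancel-< : ∀ {m n} → m ℕ.* m ℕ.< n ℕ.* n → m ℕ.< n
square-cancel-< m²<n² = ℕ.≰⇒> λ n≤m → ℕ.<⇒≱ m²<n² (ℕ.*-mono-≤ n≤m n≤m)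

between-squares : ∀ i → .{{ℕ.NonZero i}} →
  ∃[ s ] s ℕ.* s ℕ.< i × i ℕ.≤ suc s ℕ.* suc s
between-squares (suc zero)       = 0 , s≤s z≤n , s≤s z≤n
between-squares (suc i@(suc _)) with between-squares i
... | s , s²<i , i≤ with ℕ.m≤n⇒m<n∨m≡n i≤
...   | inj₁ i< = s , ℕ.m<n⇒m<1+n s²<i , i<
-- Here `i` is the square that closes its block, so `suc i` opens the next block.
...   | inj₂ refl = suc s , ℕ.n<1+n _ ,
        ℕ.*-mono-< (ℕ.n<1+n (suc s)) (ℕ.n<1+n (suc s))

module _ (f : ℕ⁺ → ℕ⁺) where

  -- Serves as a monotone majorant, since `f` itself need not be monotone.
  partialSum : ℕ → ℕ
  partialSum zero    = 0
  partialSum (suc n) = toℕ (f (pos (suc n))) ℕ.+ partialSum n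

  partialSum-mono : ∀ {m n} → m ℕ.≤ n → partialSum m ℕ.≤ partialSum n
  partialSum-mono {n = zero}  z≤n = z≤n
  partialSum-mono {n = suc n} m≤n with ℕ.m≤n⇒m<n∨m≡n m≤n
  ... | inj₁ (s≤s m≤n′) = ℕ.≤-trans (partialSum-mono m≤n′) (ℕ.m≤n+m _ _)
  ... | inj₂ refl       = ℕ.≤-refl

  ≤-partialSum : ∀ i → toℕ (f i) ℕ.≤ partialSum (toℕ i)
  ≤-partialSum (pos (suc n)) = ℕ.m≤m+n _ _

∈-positives-≤ : ∀ {s} v → toℕ v ℕ.≤ s → v ∈ˡ map (λ k → pos (suc k)) (upTo s)
∈-positives-≤ (pos (suc k)) k<s = ∈-map⁺ (λ k → pos (suc k)) (∈-upTo⁺ k<s)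

-- Filters and their sums

-- A filter F stands for the closed set of the ultrafilters above F.

record IsFilter {X : Set} (F : Pred (Pred X 0ℓ) 0ℓ) : Set₁ where
  field
    U∈     : U ∈ F
    ∅∉     : ∅ ∉ F
    upward : ∀ {A B} → A ⊆ B → A ∈ F → B ∈ F
    meet   : ∀ {A B} → A ∈ F → B ∈ F → A ∩ B ∈ F

open IsFilter

ultra-isFilter : ∀ {X} (p : Ultrafilter X) → IsFilter (Large p)
ultra-isFilter p = record
  { U∈ = U-large p ; ∅∉ = ∅-small p ; upward = ⊆-closed p ; meet = ∩-closed p }

Family : Set₁
Family = Pred (Pred ℕ⁺ 0ℓ) 0ℓ

infix 25 _/_
_/_ : Pred ℕ⁺ 0ℓ → Family → Pred ℕ⁺ 0ℓ
(A / G) v = (λ w → v +⁺ w ∈ A) ∈ G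

-- Sum of filters: Large (q + p) is Large q · Large p.
infixl 7 _·_
_·_ : Family → Family → Family
(F · G) A = A / G ∈ F

-- The least filter; its closed set is all of βℕ. Thus `F ⊆ 𝟙 · F` expresses translation invariance
-- of `F`.
𝟙 : Family
𝟙 A = ∀ n → n ∈ A

𝟙-isFilter : IsFilter 𝟙
𝟙-isFilter = record
  { U∈ = λ _ → tt ; ∅∉ = λ h → h (pos 1)
  ; upward = λ A⊆B h n → A⊆B (h n) ; meet = λ a b n → a n , b n }

𝟙⊆ : ∀ {F} → IsFilter F → 𝟙 ⊆ F
𝟙⊆ filter h = upward filter (λ {n} _ → h n) (U∈ filter)

·-isFilter : ∀ {F G} → IsFilter F → IsFilter G → IsFilter (F · G)
·-isFilter filterF filterG = record
  { U∈     = upward filterF (λ _ → U∈ filterG) (U∈ filterF)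
  ; ∅∉     = ∅∉ filterF ∘ upward filterF (∅∉ filterG)
  ; upward = λ A⊆B → upward filterF (upward filterG A⊆B)
  ; meet   = λ a b → upward filterF (λ (a , b) → meet filterG a b) (meet filterF a b)
  }

·-mono : ∀ {F F′ G G′} → IsFilter F → F ⊆ F′ → G ⊆ G′ → F · G ⊆ F′ · G′
·-mono filterF F⊆F′ G⊆G′ A∈ = F⊆F′ (upward filterF G⊆G′ A∈)

·-assocˡ : ∀ {F G H} → IsFilter F → IsFilter G → IsFilter H →
  (F · G) · H ⊆ F · (G · H)
·-assocˡ filterF filterG filterH {A} =
  upward filterF λ {a} → upward filterG λ {b} → upward filterH λ {c} →
    subst A (+⁺-assoc a b c)

module Classical (em : ∀ ℓ → ExcludedMiddle ℓ) where

  -- Rapidity of sums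

  -- Excluded middle decides equality and membership, so filtering and deduplicating a cover yields
  -- an exact enumeration that is no longer.
  covered⇒∣∣< : {X : Set} {S : Pred X 0ℓ} {n : ℕ} (xs : List X) →
    (∀ {x} → x ∈ S → x ∈ˡ xs) → length xs ℕ.< n → ∣ S ∣< n
  covered⇒∣∣< {X} {S} xs S⊆xs ∣xs∣<n =
    length ys , (ys , Unique.deduplicate-! _≟_ zs , ys-enum , refl) ,
    ℕ.≤-<-trans (ℕ.≤-trans (length-deduplicate _≟_ zs) (length-filter S? xs)) ∣xs∣<n
    where
    _≟_ : DecidableEquality X
    x ≟ y = em 0ℓ
    S? : ∀ x → Dec (S x)
    S? x = em 0ℓ
    zs = filter S? xs
    ys = deduplicate _≟_ zs
    ys-enum = λ x → mk⇔
      (λ x∈ys → proj₂ (∈-filter⁻ S? {xs = xs} (∈-deduplicate⁻ _≟_ zs x∈ys)))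
      (λ x∈S → ∈-deduplicate⁺ _≟_ (∈-filter⁺ S? (S⊆xs x∈S) x∈S))

  <⁺-empty : {A : Pred ℕ⁺ 0ℓ} {n : ℕ⁺} → ∣ A ∩ (_<⁺ n) ∣< 1 →
    ∀ {w} → w ∈ A → toℕ n ℕ.≤ toℕ w
  <⁺-empty (.0 , ([] , _ , enum , refl) , s≤s z≤n) {w} w∈A = ℕ.≮⇒≥ λ w<n →
    contradiction (Equivalence.from (enum w) (w∈A , w<n)) λ ()

  -- Applying rapidity to a constant function at i = 1.
  rapid-tail : ∀ {p} → Rapid p → ∀ n → (λ w → n ℕ.≤ toℕ w) ∈ᵘ p
  rapid-tail {p} rapid n with rapid (λ _ → pos (suc n))
  ... | A , A∈p , small = ⊆-closed p
    (λ w∈A → ℕ.≤-trans (ℕ.n≤1+n n) (<⁺-empty (small (pos 1)) w∈A)) A∈p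

  -- Let h(t) = f(1) + ⋯ + f(t²), and let A ∈ p have at most s elements ≤ h(s+1)
  -- for every s.  If s² < i ≤ (s+1)², a sum v + w < f(i) with w ∈ A and
  -- h(v+1) ≤ w has v ≤ s and w < h(s+1), so there are at most s² < i such sums.
  rapid-+ : ∀ {p} → Rapid p → ∀ q r → r ≈ q + p → Rapid r
  rapid-+ {p} rapid q r (_ , q+p⊆r) f
    -- The successor turns `<` into `≤ h j` and keeps the value positive; fewer than `suc s`
    -- elements means at most `s`.
    with rapid (λ j → pos (suc (partialSum f (toℕ j ℕ.* toℕ j))))
  ... | A , A∈p , small = B , q+p⊆r B B∈q+p , B-small
    where
    h : ℕ → ℕ
    h t = partialSum f (t ℕ.* t)

    B : Pred ℕ⁺ 0ℓ
    B n = ∃[ v ] ∃[ w ] n ≡ v +⁺ w × w ∈ A × h (suc (toℕ v)) ℕ.≤ toℕ w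

    B∈q+p : B ∈ᵘ q + p
    B∈q+p = ⊆-closed q (λ {v} _ → ⊆-closed p (λ {w} (w∈A , h≤w) → v , w , refl , w∈A , h≤w)
      (∩-closed p A∈p (rapid-tail {p} rapid (h (suc (toℕ v)))))) (U-large q)

    B-small : ∀ i → ∣ B ∩ (_<⁺ f i) ∣< toℕ i
    B-small i@(pos i′) with between-squares i′
    ... | s , s²<i , i≤ with small (pos (suc s))
    ...   | k , (ws , _ , enum , refl) , s≤s k≤s = covered⇒∣∣< (cartesianProductWith _+⁺_ vs ws)
            covers (ℕ.≤-<-trans bound s²<i)
      where
      vs = map (λ k → pos (suc k)) (upTo s)

      bound : length (cartesianProductWith _+⁺_ vs ws) ℕ.≤ s ℕ.* s
      bound = ℕ.≤-trans (ℕ.≤-reflexive (length-cartesianProductWith _+⁺_ vs ws))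
        (ℕ.*-mono-≤ (ℕ.≤-reflexive (trans (length-map _ (upTo s)) (length-upTo s))) k≤s)

      covers : ∀ {n} → n ∈ B ∩ (_<⁺ f i) → n ∈ˡ cartesianProductWith _+⁺_ vs ws
      covers ((v , w , refl , w∈A , h≤w) , v+w<fi) = ∈-cartesianProductWith⁺ _+⁺_
        (∈-positives-≤ v (ℕ.≤-pred (ℕ.<⇒≤ v+1<s+1)))
        (Equivalence.from (enum w) (w∈A , s≤s (ℕ.<⇒≤ (ℕ.<-≤-trans w<hi (partialSum-mono f i≤)))))
        where
        w<hi : toℕ w ℕ.< partialSum f i′
        w<hi = ℕ.<-≤-trans (ℕ.≤-<-trans (ℕ.m≤n+m (toℕ w) (toℕ v)) v+w<fi) (≤-partialSum f i)
        -- If `i ≤ (v+1)²`, monotonicity would give `partialSum f i ≤ h (v+1) ≤ w`, against `w<hi`.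
        v+1<s+1 : suc (toℕ v) ℕ.< suc s
        v+1<s+1 = square-cancel-< (ℕ.<-≤-trans
          (ℕ.≰⇒> λ i≤v → ℕ.<⇒≱ w<hi (ℕ.≤-trans (partialSum-mono f i≤v) h≤w)) i≤)

  -- Resizing and Zorn's lemma

  module _ {ℓ : Level} where
    -- Resizing a proposition into Set keeps unions of families indexed by large
    -- types among the Set-valued predicates.
    ∥_∥ : Set ℓ → Set
    ∥ P ∥ = T (does (em ℓ {P}))

    ∣_∣ : {P : Set ℓ} → P → ∥ P ∥
    ∣_∣ {P} x with em ℓ {P}
    ... | yes _ = tt
    ... | no ¬x = ¬x x

    extract : {P : Set ℓ} → ∥ P ∥ → P
    extract {P} t with em ℓ {P}
    ... | yes x = x

    -- Passing through Booleans gives an equality of types, as needed to make canonical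
    -- representatives equal by function extensionality.
    ∥∥-cong : {P Q : Set ℓ} → (P → Q) → (Q → P) → ∥ P ∥ ≡ ∥ Q ∥
    ∥∥-cong f g = cong T (does-⇔ (mk⇔ f g) (em ℓ) (em ℓ))

  module _ {a} {X : Set a} where

    ⋃ : ∀ {ℓ} → Pred (Pred X 0ℓ) ℓ → Pred X 0ℓ
    ⋃ C x = ∥ (∃[ F ] F ∈ C × x ∈ F) ∥

    ⊆-⋃ : ∀ {ℓ} {C : Pred (Pred X 0ℓ) ℓ} {F} → F ∈ C → F ⊆ ⋃ C
    ⊆-⋃ F∈C x∈F = ∣ (_ , F∈C , x∈F) ∣

    ⋃-least : ∀ {ℓ} {C : Pred (Pred X 0ℓ) ℓ} {G : Pred X 0ℓ} → (∀ {F} → F ∈ C → F ⊆ G) → ⋃ C ⊆ G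
    ⋃-least C⊆G x∈⋃ with extract x∈⋃
    ... | F , F∈C , x∈F = C⊆G F∈C x∈F

    IsChain : ∀ {ℓ} → Pred (Pred X 0ℓ) ℓ → Set _
    IsChain C = ∀ {F G} → F ∈ C → G ∈ C → F ⊆ G ⊎ G ⊆ F

    -- Chains are nonempty because the empty union is not a filter.
    ChainClosed : ∀ {ℓ} → Pred (Pred X 0ℓ) ℓ → Set _
    ChainClosed P = ∀ (C : Pred (Pred X 0ℓ) 0ℓ) → ∃[ F ] F ∈ C →
      C ⊆ P → IsChain C → ⋃ C ∈ P

    module Zorn (ext : ∀ a b → Extensionality a b) {ℓ} {P : Pred (Pred X 0ℓ) ℓ}
                (P-chain : ChainClosed P) {F₀ : Pred X 0ℓ} (F₀∈P : F₀ ∈ P) where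

      -- Extensionally equal sets have the same canonical representative, so
      -- a choice made from the representative respects extensional equality.
      canonical : Pred X 0ℓ → Pred X 0ℓ
      canonical F = ⋃ (λ G → ∥ G ≡ F ∥)

      canonical-cong : ∀ {F G} → F ⊆ G → G ⊆ F → canonical F ≡ canonical G
      canonical-cong {F} {G} F⊆G G⊆F = ext _ _ λ x → ∥∥-cong
        (λ (H , H≡F , x∈H) → G , ∣ refl ∣ , F⊆G (subst (x ∈_) (extract H≡F) x∈H))
        (λ (H , H≡G , x∈H) → F , ∣ refl ∣ , G⊆F (subst (x ∈_) (extract H≡G) x∈H))

      ⊆-canonical : ∀ {F} → F ⊆ canonical F
      ⊆-canonical = ⊆-⋃ ∣ refl ∣

      canonical-⊆ : ∀ {F} → canonical F ⊆ F
      canonical-⊆ {F} {x} = ⋃-least {C = λ G → ∥ G ≡ F ∥}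
        λ G≡F x∈G → subst (_ ∈_) (extract G≡F) x∈G

      -- `canonical F` is the union of the one-element chain of `F`, so chain closure applies and
      -- `P` need not respect extensional equality.
      canonical-∈ : ∀ {F} → F ∈ P → canonical F ∈ P
      canonical-∈ {F} F∈P = P-chain _ (F , ∣ refl ∣)
        (λ G≡F → subst P (sym (extract G≡F)) F∈P)
        λ G≡F H≡F → inj₁ λ {x} →
          subst (x ∈_) (trans (extract G≡F) (sym (extract H≡F)))

      ProperExtension : Pred X 0ℓ → Set _
      ProperExtension F = ∃[ G ] (G ∈ P × F ⊆ G × ¬ G ⊆ F)

      -- A positive decision carries a witness, so excluded middle for arbitrary types acts as the
      -- choice function.
      extend : (F : Pred X 0ℓ) → Dec (ProperExtension F) → Pred X 0ℓ
      extend F (yes (G , _)) = G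
      extend F (no _)        = F

      next : Pred X 0ℓ → Pred X 0ℓ
      next F = extend (canonical F) (em _)

      next-cong : ∀ {F G} → F ⊆ G → G ⊆ F → next F ⊆ next G
      next-cong F⊆G G⊆F {x} =
        subst (λ H → x ∈ extend H (em _)) (canonical-cong F⊆G G⊆F)

      ⊆-extend : ∀ {F} d → F ⊆ extend F d
      ⊆-extend (yes (_ , _ , F⊆G , _)) = F⊆G
      ⊆-extend (no _)                  = id

      ⊆-next : ∀ {F} → F ⊆ next F
      ⊆-next x∈F = ⊆-extend (em _) (⊆-canonical x∈F)

      extend-∈ : ∀ {F} d → F ∈ P → extend F d ∈ P
      extend-∈ (yes (_ , G∈P , _)) _   = G∈P
      extend-∈ (no _)              F∈P = F∈P

      extend-maximal : ∀ {F} d → extend F d ⊆ F → ¬ ProperExtension F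
      extend-maximal (yes (_ , _ , _ , G⊈F)) G⊆F = contradiction (λ {x} → G⊆F {x}) G⊈F
      extend-maximal (no maximal)            _   = maximal

      -- The tower of the Bourbaki-Witt argument. `join` accepts any nonempty collection; that its
      -- members are comparable is proved in `tower-chain`.
      data Tower : Pred X 0ℓ → Set (lsuc 0ℓ ⊔ a) where
        base : Tower F₀
        step : ∀ {F} → Tower F → Tower (next F)
        join : (C : Pred (Pred X 0ℓ) 0ℓ) → ∃[ F ] F ∈ C →
          (∀ {F} → F ∈ C → Tower F) → Tower (⋃ C)

      base-⊆ : ∀ {F} → Tower F → F₀ ⊆ F
      base-⊆ base                   = id
      base-⊆ (step F)           x∈  = ⊆-next (base-⊆ F x∈)
      base-⊆ (join C (F , F∈C) t) x∈ = ⊆-⋃ F∈C (base-⊆ (t F∈C) x∈)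

      Extreme : Pred X 0ℓ → Set _
      Extreme G = ∀ {F} → Tower F → F ⊆ G → G ⊆ F ⊎ next F ⊆ G

      -- Induction on the tower of `F`: steps cannot jump over an extreme `G`.
      extreme-comparable : ∀ {F G} → Extreme G → Tower G → Tower F → F ⊆ G ⊎ next G ⊆ F
      extreme-comparable eG tG base = inj₁ (base-⊆ tG)
      extreme-comparable eG tG (step tF) with extreme-comparable eG tG tF
      ... | inj₂ nG⊆F = inj₂ (λ x∈ → ⊆-next (nG⊆F x∈))
      ... | inj₁ F⊆G with eG tF F⊆G
      ...   | inj₁ G⊆F = inj₂ (next-cong G⊆F F⊆G)
      ...   | inj₂ nF⊆G = inj₁ nF⊆G
      extreme-comparable {G = G} eG tG (join C _ t)
        with em _ {∃[ F ] Σ[ F∈C ∈ F ∈ C ] next G ⊆ F}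
      ... | yes (F , F∈C , nG⊆F) = inj₂ (λ x∈ → ⊆-⋃ F∈C (nG⊆F x∈))
      ... | no none = inj₁ (⋃-least λ F∈C →
        [ id , (λ nG⊆F → contradiction (_ , F∈C , nG⊆F) none) ]′
          (extreme-comparable eG tG (t F∈C)))

      extreme : ∀ {G} → Tower G → Extreme G
      extreme base tF F⊆ = inj₁ (base-⊆ tF)
      extreme (step tG) tF F⊆ with extreme-comparable (extreme tG) tG tF
      ... | inj₂ nG⊆F = inj₁ nG⊆F
      ... | inj₁ F⊆G with extreme tG tF F⊆G
      ...   | inj₁ G⊆F = inj₂ (next-cong F⊆G G⊆F)
      ...   | inj₂ nF⊆G = inj₂ (λ x∈ → ⊆-next (nF⊆G x∈))
      extreme (join C _ t) {F} tF F⊆ with em _ {∃[ G ] Σ[ G∈C ∈ G ∈ C ] ¬ G ⊆ F}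
      ... | no none = inj₁ (⋃-least λ {G} G∈C →
        decidable-stable (em _ {G ⊆ F}) (λ G⊈F → none (_ , G∈C , G⊈F)))
      ... | yes (G , G∈C , G⊈F) with extreme-comparable (extreme (t G∈C)) (t G∈C) tF
      ...   | inj₂ nG⊆F = contradiction (λ {_} x∈ → nG⊆F (⊆-next x∈)) G⊈F
      ...   | inj₁ F⊆G with extreme (t G∈C) tF F⊆G
      ...     | inj₁ G⊆F = contradiction (λ {_} → G⊆F) G⊈F
      ...     | inj₂ nF⊆G = inj₂ (λ x∈ → ⊆-⋃ G∈C (nF⊆G x∈))

      tower-chain : IsChain Tower
      tower-chain tF tG with extreme-comparable (extreme tG) tG tF
      ... | inj₁ F⊆G  = inj₁ F⊆G
      ... | inj₂ nG⊆F = inj₂ (λ x∈ → nG⊆F (⊆-next x∈))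

      tower-∈ : ∀ {F} → Tower F → F ∈ P
      tower-∈ base         = F₀∈P
      tower-∈ (step tF)    = extend-∈ (em _) (canonical-∈ (tower-∈ tF))
      tower-∈ (join C inh t) = P-chain C inh (λ F∈C → tower-∈ (t F∈C))
        (λ F∈C G∈C → tower-chain (t F∈C) (t G∈C))

      top : Pred X 0ℓ
      top = ⋃ (λ F → ∥ Tower F ∥)

      -- Resizing lets the union of the whole tower be one of its own joins.
      top-tower : Tower top
      top-tower = join _ (F₀ , ∣ base ∣) extract

      -- Since `top` is in the tower, so is `next top`, whence `next top ⊆ top`: no proper extension
      -- was available to choose.
      top-maximal : ∀ {G} → G ∈ P → top ⊆ G → G ⊆ top
      top-maximal {G} G∈P top⊆G = decidable-stable (em _ {G ⊆ top}) λ G⊈top →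
        extend-maximal {canonical top} (em _)
          (λ x∈ → ⊆-canonical {top} (⊆-⋃ {C = λ F → ∥ Tower F ∥} ∣ step top-tower ∣ x∈))
          (G , G∈P , (λ x∈ → top⊆G (canonical-⊆ {top} x∈)) ,
            λ G⊆ → G⊈top λ x∈ → canonical-⊆ {top} (G⊆ x∈))

    zorn : (∀ a b → Extensionality a b) → ∀ {ℓ} {P : Pred (Pred X 0ℓ) ℓ} →
      ChainClosed P → ∀ {F₀} → F₀ ∈ P →
      ∃[ M ] (M ∈ P × F₀ ⊆ M × (∀ {G} → G ∈ P → M ⊆ G → G ⊆ M))
    zorn ext P-chain F₀∈P = top , tower-∈ top-tower , base-⊆ top-tower , top-maximal
      where open Zorn ext P-chain F₀∈P

  -- Maximal filters and ultrafilters

  -- Three choices of `Γ` are used: constantly `U` for ultrafilters, `𝟙 ·_` for minimal closed left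
  -- ideals, and `F · F` for idempotents.
  record MaximalAbove {X : Set} (Γ : Pred (Pred X 0ℓ) 0ℓ → Pred (Pred X 0ℓ) 0ℓ)
                      (F₀ : Pred (Pred X 0ℓ) 0ℓ) : Set₁ where
    field
      M        : Pred (Pred X 0ℓ) 0ℓ
      isFilter : IsFilter M
      fixed    : M ⊆ Γ M
      above    : F₀ ⊆ M
      maximal  : ∀ {G} → IsFilter G → G ⊆ Γ G → M ⊆ G → G ⊆ M

  module Filters (ext : ∀ a b → Extensionality a b) where

    maximalAbove : {X : Set} (Γ : Pred (Pred X 0ℓ) 0ℓ → Pred (Pred X 0ℓ) 0ℓ) →
      (∀ {F G} → IsFilter F → F ⊆ G → Γ F ⊆ Γ G) →
      ∀ {F} → IsFilter F → F ⊆ Γ F → MaximalAbove Γ F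
    maximalAbove {X} Γ mono filterF F⊆ΓF
      with zorn ext chainClosed (filterF , λ {_} → F⊆ΓF)
      where
      P : Pred (Pred (Pred X 0ℓ) 0ℓ) _
      P F = IsFilter F × F ⊆ Γ F
      chainClosed : ChainClosed P
      chainClosed C (F , F∈C) C⊆P chain = record
        { U∈     = ⊆-⋃ F∈C (U∈ (proj₁ (C⊆P F∈C)))
        ; ∅∉     = λ ∅∈ → let _ , G∈C , ∅∈G = extract ∅∈ in ∅∉ (proj₁ (C⊆P G∈C)) ∅∈G
        ; upward = λ A⊆B A∈ → let _ , G∈C , A∈G = extract A∈ in
            ⊆-⋃ G∈C (upward (proj₁ (C⊆P G∈C)) A⊆B A∈G)
        ; meet   = λ A∈ B∈ → let _ , G∈C , A∈G = extract A∈ ; _ , H∈C , B∈H = extract B∈ in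
            [ (λ G⊆H → ⊆-⋃ H∈C (meet (proj₁ (C⊆P H∈C)) (G⊆H A∈G) B∈H))
            , (λ H⊆G → ⊆-⋃ G∈C (meet (proj₁ (C⊆P G∈C)) A∈G (H⊆G B∈H)))
            ]′ (chain G∈C H∈C)
        } , ⋃-least (λ {G} G∈C {_} A∈G → mono (proj₁ (C⊆P G∈C))
            (⊆-⋃ {C = C} {G} G∈C) (proj₂ (C⊆P G∈C) A∈G))
    ... | M , (filterM , M⊆ΓM) , F⊆M , max = record
      { M = M ; isFilter = filterM ; fixed = M⊆ΓM ; above = F⊆M
      ; maximal = λ filterG G⊆ΓG → max (filterG , λ {_} → G⊆ΓG) }

    ultrafilterAbove : ∀ {X} {F : Pred (Pred X 0ℓ) 0ℓ} → IsFilter F →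
      Σ[ p ∈ Ultrafilter X ] F ⊆ Large p
    ultrafilterAbove {X} filterF = record
      { Large    = M
      ; U-large  = U∈ isFilter
      ; ∅-small  = ∅∉ isFilter
      ; ⊆-closed = upward isFilter
      ; ∩-closed = meet isFilter
      ; ultra    = decide
      } , above
      where
      open MaximalAbove (maximalAbove (λ _ → U) (λ _ _ _ → tt) filterF (λ _ → tt))
      decide : ∀ A → A ∈ M ⊎ ∁ A ∈ M
      decide A with em _ {∁ A ∈ M}
      ... | yes ∁A∈M = inj₂ ∁A∈M
      -- The filter generated by `M` and `A` is proper because `A ⇒ ∅` is `∁ A`; maximality puts `A`
      -- in `M`.
      ... | no  ∁A∉M = inj₁ (maximal {λ B → (A ⇒ B) ∈ M}
        (record
          { U∈     = upward isFilter (λ _ _ → tt) (U∈ isFilter)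
          ; ∅∉     = ∁A∉M
          ; upward = λ B⊆C → upward isFilter (λ A⇒B x∈A → B⊆C (A⇒B x∈A))
          ; meet   = λ B∈ C∈ → upward isFilter (λ (f , g) x∈A → f x∈A , g x∈A)
                                 (meet isFilter B∈ C∈)
          })
        (λ _ → tt)
        (upward isFilter (λ x∈B _ → x∈B))
        (upward isFilter (λ _ → id) (U∈ isFilter)))

    -- Solution filters and idempotents

    -- The filter of the closed set { q ⊇ F : q + x ⊇ G }.
    solutions : Family → Family → Family → Family
    solutions F G x B = ∥ (∃[ A ] A ∈ G × (A / x ⇒ B) ∈ F) ∥

    module _ {F G : Family} (filterF : IsFilter F) (filterG : IsFilter G) (x : βℕ) where

      ⊆-solutions : F ⊆ solutions F G (Large x)
      ⊆-solutions B∈F = ∣ (U , U∈ filterG , upward filterF (λ b _ → b) B∈F) ∣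

      /-∈-solutions : ∀ {A} → A ∈ G → A / Large x ∈ solutions F G (Large x)
      /-∈-solutions A∈G = ∣ (_ , A∈G , upward filterF (λ _ → id) (U∈ filterF)) ∣

      -- For properness: `x` is ultra, so outside `A / x` the sections of `∁ A` are in `x`. Hence
      -- `∁ (A / x) ∈ F` would put `∁ A` in `G` beside `A`.
      solutions-isFilter : F · Large x ⊆ G → IsFilter (solutions F G (Large x))
      solutions-isFilter F·x⊆G = record
        { U∈     = ⊆-solutions (U∈ filterF)
        ; ∅∉     = λ ∅∈ → let A , A∈G , ∁[A/x]∈F = extract ∅∈ in
            ∅∉ filterG (upward filterG {A ∩ ∁ A} (λ (a , ¬a) → ¬a a) (meet filterG A∈G
              (F·x⊆G {∁ A} (upward filterF
                (λ {v} ∉ → [ (λ ∈x → contradiction ∈x ∉) , id ]′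
                  (ultra x (λ w → A (v +⁺ w))))
                ∁[A/x]∈F))))
        ; upward = λ B⊆C B∈ → let A , A∈G , h = extract B∈ in
            ∣ (A , A∈G , upward filterF (λ f a → B⊆C (f a)) h) ∣
        ; meet   = λ B∈ C∈ → let A , A∈G , h = extract B∈ ; A′ , A′∈G , h′ = extract C∈ in
            ∣ (A ∩ A′ , meet filterG A∈G A′∈G , upward filterF
                (λ (f , g) a → f (⊆-closed x proj₁ a) , g (⊆-closed x proj₂ a))
                (meet filterF h h′)) ∣
        }

    ⊆⇒≈ : ∀ {p q : βℕ} → Large p ⊆ Large q → p ≈ q
    ⊆⇒≈ {p} {q} p⊆q = (λ _ → p⊆q) , λ A A∈q →
      [ id , (λ ∁A∈p → contradiction
        (⊆-closed q {A ∩ ∁ A} (λ (a , ¬a) → ¬a a) (∩-closed q A∈q (p⊆q ∁A∈p))) (∅-small q)) ]′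
      (ultra p A)

    -- 𝟙 · Large p is the filter of the closed left ideal βℕ + p.
    𝟙·⊆⇒∈βℕ+ : ∀ {p e} → 𝟙 · Large p ⊆ Large e → e ∈ (βℕ+ p)
    𝟙·⊆⇒∈βℕ+ {p} {e} 𝟙·p⊆e with ultrafilterAbove
      (solutions-isFilter 𝟙-isFilter (ultra-isFilter e) p 𝟙·p⊆e)
    ... | q , ⊆q = q , ⊆⇒≈ {e} {q + p}
      (λ A∈e → ⊆q (/-∈-solutions 𝟙-isFilter (ultra-isFilter e) p A∈e))

    -- Solutions of q + x = x are closed under addition; on filters this is the
    -- identity (A / x) - u = (A - u) / x, where A - u = { w : u + w ∈ A }.
    solutions-idempotent : ∀ {F} → IsFilter F → F ⊆ F · F → (x : βℕ) → F · Large x ⊆ Large x →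
      let K = solutions F (Large x) (Large x) in K ⊆ K · K
    solutions-idempotent {F} filterF F⊆F·F x F·x⊆x {B} B∈K
      with A , A∈x , h ← extract B∈K =
      -- By modus ponens it suffices to treat a member of `F` and a set `A / x` separately.
      upward filterK·K {(A / Large x ⇒ B) ∩ A / Large x} (λ (f , a) → f a)
        (meet filterK·K {A / Large x ⇒ B} {A / Large x} (F⊆K·K h) A/x∈K·K)
      where
      filterX = ultra-isFilter x
      K = solutions F (Large x) (Large x)
      F⊆K : F ⊆ K
      F⊆K = ⊆-solutions filterF filterX x
      filterK : IsFilter K
      filterK = solutions-isFilter filterF filterX x F·x⊆x
      filterK·K : IsFilter (K · K)
      filterK·K = ·-isFilter filterK filterK
      F⊆K·K : F ⊆ K · K
      F⊆K·K {C} C∈F = ·-mono {F} {K} {F} {K} filterF F⊆K F⊆K {C} (F⊆F·F C∈F)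
      A/x∈K·K : A / Large x ∈ K · K
      A/x∈K·K = upward filterK
        (λ {u} A-u∈x → upward filterK
          (λ {v} → ⊆-closed x (λ {w} → subst A (sym (+⁺-assoc u v w))))
          (/-∈-solutions filterF filterX x A-u∈x))
        (/-∈-solutions filterF filterX x A∈x)

    -- For a maximal M with M ⊆ M · M and an ultrafilter x ⊇ M, maximality applies
    -- first to M · x and then to solutions M x x; hence x ⊆ M · x ⊆ M.
    idempotentAbove : ∀ {F} → IsFilter F → F ⊆ F · F →
      Σ[ e ∈ βℕ ] F ⊆ Large e × IsIdempotent e
    idempotentAbove filterF F⊆F·F with
      maximalAbove (λ F → F · F)
        (λ {F} {G} filterF F⊆G {A} → ·-mono {F} {G} {F} {G} filterF F⊆G F⊆G {A})
        filterF F⊆F·F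
    ... | record { M = M ; isFilter = filterM ; fixed = M⊆M·M ; above = F⊆M ; maximal = maximal }
      with ultrafilterAbove filterM
    ...   | x , M⊆x = x , (λ A∈F → M⊆x (F⊆M A∈F)) , proj₂ x≈x+x , proj₁ x≈x+x
      where
      X = Large x
      filterX = ultra-isFilter x

      M⊆M·X : M ⊆ M · X
      M⊆M·X {A} A∈M = ·-mono {M} {M} {M} {X} filterM id M⊆x {A} (M⊆M·M A∈M)

      -- `M · X ⊆ (M · M) · X ⊆ ((M · X) · M) · X`, then reassociate.
      M·X⊆[M·X]·[M·X] : M · X ⊆ (M · X) · (M · X)
      M·X⊆[M·X]·[M·X] {A} A∈M·X =
        ·-assocˡ (·-isFilter filterM filterX) filterM filterX {A}
          (M⊆M·X {(A / X) / M} (M⊆M·M {A / X} A∈M·X))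

      M·X⊆M : M · X ⊆ M
      M·X⊆M = maximal (·-isFilter filterM filterX)
        (λ {A} → M·X⊆[M·X]·[M·X] {A}) M⊆M·X

      M·X⊆X : M · X ⊆ X
      M·X⊆X {A} A∈M·X = M⊆x (M·X⊆M {A} A∈M·X)

      X⊆M : X ⊆ M
      X⊆M {A} A∈x = M·X⊆M {A} (maximal
        (solutions-isFilter filterM filterX x M·X⊆X)
        (solutions-idempotent filterM M⊆M·M x M·X⊆X)
        (⊆-solutions filterM filterX x)
        (/-∈-solutions filterM filterX x A∈x))

      x≈x+x : x ≈ x + x
      x≈x+x = ⊆⇒≈ {x} {x + x} λ {A} A∈x →
        ·-mono {M} {X} {M} {X} filterM M⊆x M⊆x {A} (M⊆M·M (X⊆M A∈x))

    -- Minimal left ideals and minimal idempotents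

    𝟙·⊆𝟙·𝟙· : ∀ p → 𝟙 · Large p ⊆ 𝟙 · (𝟙 · Large p)
    𝟙·⊆𝟙·𝟙· p {A} A∈ v w = ⊆-closed p (λ {u} → subst A (+⁺-assoc v w u)) (A∈ (v +⁺ w))

    module _ {F : Family} (max : MaximalAbove (𝟙 ·_) F) where
      open MaximalAbove max

      -- By invariance the closed set of `M` is a left ideal; with `e` it contains `e′ + e`.
      ⊆-fixed : ∀ {e e′} → M ⊆ Large e → e′ + e ≈ e′ → M ⊆ Large e′
      ⊆-fixed {e} {e′} M⊆e e′+e≈e′ {A} A∈M = proj₁ e′+e≈e′ A
        (⊆-closed e′ {U} (λ {v} _ → M⊆e (fixed A∈M v)) (U-large e′))

      -- Minimality of the left ideal: `𝟙 · e′` is an invariant filter above `M`, so maximality puts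
      -- it inside `M ⊆ e`.
      ∈βℕ+ : ∀ {e e′} → M ⊆ Large e → M ⊆ Large e′ → e ∈ (βℕ+ e′)
      ∈βℕ+ {e} {e′} M⊆e M⊆e′ = 𝟙·⊆⇒∈βℕ+ {e′} {e} λ {A} A∈ → M⊆e (maximal
        (·-isFilter 𝟙-isFilter (ultra-isFilter e′))
        (λ {A} → 𝟙·⊆𝟙·𝟙· e′ {A})
        (λ A∈M v → M⊆e′ (fixed A∈M v))
        {A} A∈)

    -- With `e = q + e′`, `e + e′ = q + (e′ + e′) = q + e′ = e`.
    +-idempotent-absorb : ∀ {e e′} → IsIdempotent e′ → e ∈ (βℕ+ e′) → Large e ⊆ Large (e + e′)
    +-idempotent-absorb {e} {e′} (_ , e′⊆e′+e′) (q , e⊆q+e′ , q+e′⊆e) {A} A∈e =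
      q+e′⊆e (A / Large e′) (⊆-closed q
        (λ {v} A-v∈e′ → ⊆-closed e′
          (λ {w} → ⊆-closed e′ (λ {u} → subst A (sym (+⁺-assoc v w u))))
          (e′⊆e′+e′ (λ w → A (v +⁺ w)) A-v∈e′))
        (e⊆q+e′ A A∈e))

    minimalIdempotentIn : ∀ p → ∃[ e ] (e ∈ (βℕ+ p) × IsMinimalIdempotent e)
    minimalIdempotentIn p =
      e , 𝟙·⊆⇒∈βℕ+ {p} {e} (λ {A} A∈ → M⊆e (above {A} A∈)) , e+e≈e , minimal
      where
      𝟙·p-isFilter = ·-isFilter 𝟙-isFilter (ultra-isFilter p)
      max = maximalAbove (𝟙 ·_) (λ _ F⊆G A∈ v → F⊆G (A∈ v)) 𝟙·p-isFilter
        (λ {A} → 𝟙·⊆𝟙·𝟙· p {A})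
      open MaximalAbove max
      -- A left ideal is a subsemigroup: `M ⊆ 𝟙 · M ⊆ M · M`.
      idempotent = idempotentAbove isFilter (λ A∈M → 𝟙⊆ isFilter (fixed A∈M))
      e     = proj₁ idempotent
      M⊆e   = λ {A} → proj₁ (proj₂ idempotent) {A}
      e+e≈e = proj₂ (proj₂ idempotent)

      minimal : ∀ e′ → IsIdempotent e′ → e′ + e ≈ e′ × e + e′ ≈ e′ → e′ ≈ e
      minimal e′ e′+e′≈e′ (e′+e≈e′ , e+e′≈e′) = proj₂ e≈e′ , proj₁ e≈e′
        where
        e≈e′ : e ≈ e′
        e≈e′ = ⊆⇒≈ {e} {e′} λ {A} A∈e → proj₁ e+e′≈e′ A
          (+-idempotent-absorb {e} {e′} e′+e′≈e′
            (∈βℕ+ max {e} {e′} M⊆e (⊆-fixed max {e} {e′} M⊆e e′+e≈e′)) {A} A∈e)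

theorem4 : (∀ ℓ → ExcludedMiddle ℓ) →
    (∀ a b → Extensionality a b) →
    ((∃[ p ] Rapid p) → ∃[ e ] (Rapid e × IsIdempotent e))
    × (∀ p → Rapid p →
    (∀ r → r ∈ (βℕ+ p) → Rapid r)
    × (∃[ e ] (e ∈ (βℕ+ p) × IsMinimalIdempotent e × Rapid e)))
theorem4 em ext =
  (λ (p , rapid) → let e , _ , (e+e≈e , _) , e-rapid = minimalRapid p rapid in
    e , e-rapid , e+e≈e) ,
  λ p rapid → ideal-rapid p rapid , minimalRapid p rapid
  where
  open Classical em
  open Filters ext

  ideal-rapid : ∀ p → Rapid p → ∀ r → r ∈ (βℕ+ p) → Rapid r
  ideal-rapid p rapid r (q , r≈q+p) = rapid-+ {p} rapid q r r≈q+p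

  minimalRapid : ∀ p → Rapid p → ∃[ e ] (e ∈ (βℕ+ p) × IsMinimalIdempotent e × Rapid e)
  minimalRapid p rapid = let e , e∈ , e-min = minimalIdempotentIn p in
    e , e∈ , e-min , ideal-rapid p rapid e e∈
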